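{- Let $D$ be a strongly connected balanced bipartite digraph of order $2a\geq 8$. Suppose that $d(x)+d(y)\geq 4a-3$ for every pair of distinct vertices $x,y$ with a common out-neighbour. If $D$ is not isomorphic to the digraph $D(8)$, then $D$ is hamiltonian.
   Context: Digraphs are finite, without loops and without multiple arcs (a pair of opposite arcs $x\to y$, $y\to x$, called a 2-cycle $x\leftrightarrow y$, is allowed). For a vertex $x$, $d(x)=d^+(x)+d^-(x)$ is the sum of its out-degree and in-degree. A bipartite digraph with partite sets $X,Y$ is balanced if $|X|=|Y|$. A digraph is hamiltonian if it has a directed cycle through all its vertices. $D(8)$ is the bipartite digraph with partite sets $X=\{x_0,x_1,x_2,x_3\}$, $Y=\{y_0,y_1,y_2,y_3\}$ whose arc set consists exactly of the arcs $y_0x_1$, $y_1x_0$, $x_2y_3$, $x_3y_2$ together with both arcs of each of the 2-cycles $x_i\leftrightarrow y_i$ ($i=0,1,2,3$), $y_0\leftrightarrow x_2$, $y_0\leftrightarrow x_3$, $y_1\leftrightarrow x_2$, $y_1\leftrightarrow x_3$. -}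

module Defs where

open import Data.Nat using (ℕ; zero; suc; _+_)
open import Data.Bool using (Bool; true; false)
open import Data.Fin using (Fin; zero; suc)
open import Data.Fin.Properties using () renaming (_≟_ to _≟F_)
open import Data.Sum using (_⊎_; inj₁; inj₂)
open import Data.Product using (_×_)
open import Data.Empty using (⊥)
open import Data.List using (List; []; _∷_; _++_; map; length; filterᵇ)
open import Data.List.Relation.Unary.Unique.Propositional using (Unique)
open import Data.List.Membership.Propositional using (_∈_)
open import Data.Fin using (Fin)
open import Data.List using (allFin)
open import Relation.Binary.PropositionalEquality using (_≡_)
open import Relation.Binary.Construct.Closure.ReflexiveTransitive using (Star)
open import Function.Bundles using (_↔_; Inverse)

-- A bipartite digraph with partite sets X = Y-size = a (i.e. balanced),
-- vertices x_i = inj₁ i ∈ X and y_j = inj₂ j ∈ Y.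
-- xy i j = true  iff  arc x_i → y_j ;  yx j i = true  iff  arc y_j → x_i.
-- No arcs inside a partite set, no loops, no multiple arcs (Bool-valued).
record BipDigraph (a : ℕ) : Set where
  field
    xy : Fin a → Fin a → Bool
    yx : Fin a → Fin a → Bool

module _ {a : ℕ} (D : BipDigraph a) where
  open BipDigraph D

  Vertex : Set
  Vertex = Fin a ⊎ Fin a

  arc : Vertex → Vertex → Bool
  arc (inj₁ i) (inj₁ j) = false
  arc (inj₁ i) (inj₂ j) = xy i j
  arc (inj₂ j) (inj₁ i) = yx j i
  arc (inj₂ i) (inj₂ j) = false

  Arc : Vertex → Vertex → Set
  Arc u v = arc u v ≡ true

  vertices : List Vertex
  vertices = map inj₁ (allFin a) ++ map inj₂ (allFin a)

  outdeg : Vertex → ℕ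
  outdeg v = length (filterᵇ (arc v) vertices)

  indeg : Vertex → ℕ
  indeg v = length (filterᵇ (λ u → arc u v) vertices)

  deg : Vertex → ℕ
  deg v = outdeg v + indeg v

  Reachable : Vertex → Vertex → Set
  Reachable = Star Arc

  StronglyConnected : Set
  StronglyConnected = ∀ u v → Reachable u v

  ChainArcs : Vertex → List Vertex → Vertex → Set
  ChainArcs u [] w = Arc u w
  ChainArcs u (x ∷ xs) w = Arc u x × ChainArcs x xs w

  IsCycle : List Vertex → Set
  IsCycle [] = ⊥
  IsCycle (v ∷ vs) = ChainArcs v vs v

  record Hamiltonian : Set where
    field
      cycle    : List Vertex
      distinct : Unique cycle
      covers   : ∀ v → v ∈ cycle
      isCycle  : IsCycle cycle

-- digraph isomorphism (need not respect the chosen bipartition)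
record Isomorphic {a b : ℕ} (D : BipDigraph a) (E : BipDigraph b) : Set where
  field
    bij : Vertex D ↔ Vertex E
  open Inverse bij public using (to)
  field
    preserves : ∀ u v → arc D u v ≡ arc E (to u) (to v)

private
  xy8 : Fin 4 → Fin 4 → Bool
  xy8 zero zero = true
  xy8 zero _ = false
  xy8 (suc zero) (suc zero) = true
  xy8 (suc zero) _ = false
  xy8 (suc (suc zero)) _ = true
  xy8 (suc (suc (suc zero))) _ = true

  yx8 : Fin 4 → Fin 4 → Bool
  yx8 zero _ = true
  yx8 (suc zero) _ = true
  yx8 (suc (suc zero)) (suc (suc zero)) = true
  yx8 (suc (suc zero)) _ = false
  yx8 (suc (suc (suc zero))) (suc (suc (suc zero))) = true
  yx8 (suc (suc (suc zero))) _ = false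

D8 : BipDigraph 4
D8 = record { xy = xy8 ; yx = yx8 }

{-# OPTIONS --safe #-}
module Submission where

-- Let the defect of a vertex be 2a - d(v), so that the defects of two vertices with a
-- common out-neighbour add up to at most 3.
--
-- If some vertex shares no out-neighbour with any other vertex, the same holds for its
-- out-neighbours, hence for all vertices: in-neighbours are unique and D is a cycle.
-- Otherwise all defects are at most 3. Keep one side, say Y, in an arbitrary cyclic
-- order and match the X-vertices to the a gaps: a misplaced x of gap (y, y′) can be
-- exchanged with another one as long as the defect of x plus the arcs missing out of y
-- and into y′ is at most a. When all pairs on both sides share an out-neighbour, or when
-- some pair in X does not, this bound fails for at most one x, which is placed first.

open import Defs
open import Data.Nat using (ℕ; zero; suc; _+_; _*_; _∸_; _≤_; _<_; z≤n; s≤s; _≤?_; _≟_)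
open import Data.Nat.Properties hiding (_≤?_; _≟_; suc-injective)
open import Data.Nat.Solver using (module +-*-Solver)
open import Data.Bool using (Bool; true; false; T?)
open import Data.Bool.Properties using () renaming (_≟_ to _≟B_)
open import Data.Fin using (Fin; zero; suc; fromℕ; inject₁; punchIn; punchOut)
open import Data.Fin.Properties using (any?; suc-injective; punchInᵢ≢i; punchIn-punchOut) renaming (_≟_ to _≟F_)
open import Data.Fin.Permutation using (Permutation′; _⟨$⟩ʳ_; _⟨$⟩ˡ_; transpose; _∘ₚ_; inverseʳ) renaming (id to idₚ)
open import Data.List using (List; []; _∷_; _++_; allFin; tabulate; length; filterᵇ)
open import Data.List.Properties using (filter-++; length-++; map-tabulate)
open import Data.List.Membership.Propositional using (_∈_; _∉_)
open import Data.List.Membership.Propositional.Properties using (∈-allFin)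
import Data.List.Membership.DecPropositional as DecMembership
open import Data.List.Relation.Unary.Any using (here; there)
open import Data.List.Relation.Unary.AllPairs using ([]; _∷_)
open import Data.List.Relation.Unary.All using ([]; _∷_)
open import Data.List.Relation.Unary.All.Properties using (¬Any⇒All¬)
open import Data.List.Relation.Unary.Unique.Propositional using (Unique)
open import Data.Product using (∃; _×_; _,_; proj₁; proj₂)
open import Data.Sum using (_⊎_; inj₁; inj₂)
open import Data.Sum.Properties using (inj₁-injective; inj₂-injective; ≡-dec)
open import Function using (_∘_; id; Injection)
open import Function.Properties.Inverse using (↔⇒↣)
open import Relation.Binary.Construct.Closure.ReflexiveTransitive using (Star; ε; _◅_)
open import Relation.Binary.PropositionalEquality using (_≡_; _≢_; refl; sym; trans; cong; cong₂; subst)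
open import Relation.Nullary using (¬_; Dec; yes; no; ¬?; _×-dec_)
open import Relation.Nullary.Decidable using (decidable-stable)
open import Relation.Nullary.Negation using (contradiction)
open import Algebra.Properties.CommutativeMonoid.Sum +-0-commutativeMonoid
  using (sum; sum-remove; sum-permute; sum-init-last; ∑-distrib-+)
open import Algebra.Properties.CommutativeSemigroup +-commutativeSemigroup
  using () renaming (interchange to +-interchange)

open ≤-Reasoning

-- Sums of naturals and the pigeonhole principle.

sum<n⇒∃zero : ∀ {n} (w : Fin n → ℕ) → sum w < n → ∃ λ j → w j ≡ 0
sum<n⇒∃zero {suc n} w lt with w zero in eq
... | zero  = zero , eq
... | suc m with sum<n⇒∃zero (w ∘ suc) (≤-trans (s≤s (m≤n+m _ m)) (≤-pred lt))
...   | j , wj≡0 = suc j , wj≡0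

-- Without index i the other n - 1 values sum to less than n - 1, so the pigeonhole gives a zero
-- elsewhere.
1+sum<n+w⇒∃zero : ∀ {n} (w : Fin n → ℕ) i → suc (sum w) < n + w i → ∃ λ j → j ≢ i × w j ≡ 0
1+sum<n+w⇒∃zero {suc n} w i lt =
  let j , wj≡0 = sum<n⇒∃zero (w ∘ punchIn i) (+-cancelʳ-< (w i) _ _ rest)
  in punchIn i j , punchInᵢ≢i i j , wj≡0
  where
  rest : sum (w ∘ punchIn i) + w i < n + w i
  rest = ≤-pred (subst (λ s → suc s < suc n + w i)
    (trans (sum-remove {i = i} w) (+-comm (w i) _)) lt)

≤sum : ∀ {n} (w : Fin n → ℕ) i → w i ≤ sum w
≤sum {suc n} w i = subst (w i ≤_) (sym (sum-remove {i = i} w)) (m≤m+n (w i) _)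

+≤sum : ∀ {n} (w : Fin n → ℕ) {i j} → i ≢ j → w i + w j ≤ sum w
+≤sum {suc n} w {i} {j} i≢j = begin
  w i + w j                       ≡⟨ cong (λ k → w i + w k) (punchIn-punchOut i≢j) ⟨
  w i + w (punchIn i (punchOut i≢j)) ≤⟨ +-monoʳ-≤ (w i) (≤sum (w ∘ punchIn i) (punchOut i≢j)) ⟩
  w i + sum (w ∘ punchIn i)       ≡⟨ sum-remove w ⟨
  sum w                           ∎

sum-mono : ∀ {n} (v w : Fin n → ℕ) → (∀ i → v i ≤ w i) → sum v ≤ sum w
sum-mono {zero}  v w v≤w = z≤n
sum-mono {suc n} v w v≤w = +-mono-≤ (v≤w zero) (sum-mono (v ∘ suc) (w ∘ suc) (v≤w ∘ suc))

sum≤n : ∀ {n} (w : Fin n → ℕ) → (∀ i → w i ≤ 1) → sum w ≤ n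
sum≤n {zero}  w w≤1 = z≤n
sum≤n {suc n} w w≤1 = +-mono-≤ (w≤1 zero) (sum≤n (w ∘ suc) (w≤1 ∘ suc))

-- Two entries equal to 2 would break the pair bound, so at most one entry exceeds 1.
sum≤1+n : ∀ {n} (w : Fin n → ℕ) → (∀ i → 1 ≤ w i) → (∀ i → w i ≤ 2) →
          (∀ {i j} → i ≢ j → w i + w j ≤ 3) → sum w ≤ suc n
sum≤1+n {zero}  w 1≤w w≤2 pair = z≤n
sum≤1+n {suc n} w 1≤w w≤2 pair with w zero ≤? 1
... | yes w₀≤1 = +-mono-≤ w₀≤1
      (sum≤1+n (w ∘ suc) (1≤w ∘ suc) (w≤2 ∘ suc) λ i≢j → pair λ { refl → i≢j refl })
... | no  w₀≰1 = +-mono-≤ (w≤2 zero) (sum≤n (w ∘ suc) λ i →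
      +-cancelˡ-≤ 2 _ _ (≤-trans (+-monoˡ-≤ (w (suc i)) (≰⇒> w₀≰1)) (pair λ ())))

-- Transpositions and the cyclic predecessor.

transpose-matchˡ : ∀ {n} (i j : Fin n) → transpose i j ⟨$⟩ʳ i ≡ j
transpose-matchˡ i j with i ≟F i
... | yes _   = refl
... | no  i≢i = contradiction refl i≢i

transpose-matchʳ : ∀ {n} (i j : Fin n) → transpose i j ⟨$⟩ʳ j ≡ i
transpose-matchʳ i j with j ≟F i
... | yes j≡i = j≡i
... | no  _ with j ≟F j
...   | yes _   = refl
...   | no  j≢j = contradiction refl j≢j

transpose-mismatch : ∀ {n} {i j k : Fin n} → k ≢ i → k ≢ j → transpose i j ⟨$⟩ʳ k ≡ k
transpose-mismatch {i = i} {j} {k} k≢i k≢j with k ≟F i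
... | yes k≡i = contradiction k≡i k≢i
... | no  _ with k ≟F j
...   | yes k≡j = contradiction k≡j k≢j
...   | no  _   = refl

-- The split into `fromℕ` and `inject₁` matches both the decomposition of a sum by `sum-init-last`
-- and the way `alternate-chain` takes its arcs.
cpred : ∀ {n} → Fin (suc n) → Fin (suc n)
cpred {n} zero = fromℕ n
cpred (suc i)  = inject₁ i

cpred≢ : ∀ {n} (i : Fin (suc (suc n))) → cpred i ≢ i
cpred≢ zero    ()
cpred≢ (suc i) = inject₁≢suc i
  where
  inject₁≢suc : ∀ {n} (i : Fin n) → inject₁ i ≢ suc i
  inject₁≢suc (suc i) eq = inject₁≢suc i (suc-injective eq)

sum-cpred : ∀ {n} (w : Fin (suc n) → ℕ) → sum (w ∘ cpred) ≡ sum w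
sum-cpred {n} w = trans (+-comm (w (fromℕ n)) _) (sym (sum-init-last w))

-- Missing arcs.

miss : Bool → ℕ
miss true  = 0
miss false = 1

miss≡0 : ∀ {b} → miss b ≡ 0 → b ≡ true
miss≡0 {true} _ = refl

Matrix : ℕ → Set
Matrix a = Fin a → Fin a → Bool

row col : ∀ {a} → Matrix a → Fin a → ℕ
row m i = sum λ j → miss (m i j)
col m j = sum λ i → miss (m i j)

-- The number of arcs missing at vertex i of the side with out-arcs m and in-arcs m′.
defect : ∀ {a} → Matrix a → Matrix a → Fin a → ℕ
defect m m′ i = row m i + col m′ i

-- Repairing an arrangement by exchanges.

-- The Y-vertices stay in a fixed cyclic order with predecessor map p;
-- gap i x counts the arcs missing when x is placed between p i and i.
module Arrangement {a} (p : Fin a → Fin a) (p≢ : ∀ i → p i ≢ i)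
  (sum-p : ∀ w → sum (w ∘ p) ≡ sum w) (xy yx : Matrix a) where

  gap : Fin a → Fin a → ℕ
  gap i x = miss (yx (p i) x) + miss (xy x i)

  -- As i runs over the gaps, `p i` and i each run over all of Y, so every arc missing at x is
  -- counted once.
  sum-gapˡ : ∀ x → sum (λ i → gap i x) ≡ defect xy yx x
  sum-gapˡ x = begin-equality
    sum (λ i → gap i x)         ≡⟨ ∑-distrib-+ (λ i → miss (yx (p i) x)) (λ i → miss (xy x i)) ⟩
    sum (λ i → miss (yx (p i) x)) + row xy x
                                ≡⟨ cong (_+ row xy x) (sum-p λ y → miss (yx y x)) ⟩
    col yx x + row xy x         ≡⟨ +-comm (col yx x) _ ⟩
    defect xy yx x              ∎

  sum-gapʳ : ∀ (σ : Permutation′ a) i →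
             sum (λ j → gap i (σ ⟨$⟩ʳ j)) ≡ row yx (p i) + col xy i
  sum-gapʳ σ i = trans (sym (sum-permute (gap i) σ)) (∑-distrib-+ (λ x → miss (yx (p i) x)) λ x → miss (xy x i))

  module _ (c : ℕ)
    (row+col≤c : ∀ {y y′} → y ≢ y′ → row yx y + col xy y′ ≤ c) where

    Fits : Permutation′ a → Fin a → Set
    Fits σ i = gap i (σ ⟨$⟩ʳ i) ≡ 0

    -- Invariant of the repair: a vertex may be misplaced only if its defect is small enough for
    -- `swap-in`.
    Fixable : Permutation′ a → Set
    Fixable σ = ∀ i → Fits σ i ⊎ defect xy yx (σ ⟨$⟩ʳ i) + c ≤ a

    -- Exchanging x with the occupant of gap j costs `w j`. By `row+col≤c` and the bound on the
    -- defect of x, these costs sum to at most a. At j = i the cost is at least 2, so some other j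
    -- costs 0.
    swap-in : ∀ σ i → ¬ Fits σ i → defect xy yx (σ ⟨$⟩ʳ i) + c ≤ a →
              ∃ λ j → gap i (σ ⟨$⟩ʳ j) + gap j (σ ⟨$⟩ʳ i) ≡ 0
    swap-in σ i ¬fits small =
      let j , _ , eq = 1+sum<n+w⇒∃zero w i bound in j , eq
      where
      x = σ ⟨$⟩ʳ i
      w : Fin a → ℕ
      w j = gap i (σ ⟨$⟩ʳ j) + gap j x
      1≤gap : 1 ≤ gap i x
      1≤gap = n≢0⇒n>0 ¬fits
      sum-w : sum w ≡ row yx (p i) + col xy i + defect xy yx x
      sum-w = trans (∑-distrib-+ (λ j → gap i (σ ⟨$⟩ʳ j)) (λ j → gap j x))
                    (cong₂ _+_ (sum-gapʳ σ i) (sum-gapˡ x))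
      bound : suc (sum w) < a + w i
      bound = begin
        2 + sum w                                     ≡⟨ cong (2 +_) sum-w ⟩
        2 + (row yx (p i) + col xy i + defect xy yx x) ≤⟨ +-monoʳ-≤ 2 (+-monoˡ-≤ _ (row+col≤c (p≢ i))) ⟩
        2 + (c + defect xy yx x)                      ≡⟨ cong (2 +_) (+-comm c _) ⟩
        2 + (defect xy yx x + c)                      ≤⟨ +-monoʳ-≤ 2 small ⟩
        2 + a                                         ≡⟨ +-comm 2 a ⟩
        a + 2                                         ≤⟨ +-monoʳ-≤ a (+-mono-≤ 1≤gap 1≤gap) ⟩
        a + w i                                   ∎

    fit : ∀ σ → Fixable σ → ∀ i → ∃ λ σ′ →
          Fixable σ′ × Fits σ′ i × (∀ k → Fits σ k → Fits σ′ k)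
    fit σ fix i with gap i (σ ⟨$⟩ʳ i) ≟ 0 | fix i
    ... | yes fits | _         = σ , fix , fits , λ _ → id
    ... | no ¬fits | inj₁ fits = contradiction fits ¬fits
    ... | no ¬fits | inj₂ small with swap-in σ i ¬fits small
    ...   | j , eq = σ′ , fix′ , fitsᵢ , keep
      where
      -- `_∘ₚ_` applies the transposition first, so the gaps i and j exchange their occupants.
      σ′ = transpose i j ∘ₚ σ
      fitsᵢ : Fits σ′ i
      fitsᵢ = trans (cong (λ k → gap i (σ ⟨$⟩ʳ k)) (transpose-matchˡ i j))
                    (m+n≡0⇒m≡0 _ eq)
      fitsⱼ : Fits σ′ j
      fitsⱼ = trans (cong (λ k → gap j (σ ⟨$⟩ʳ k)) (transpose-matchʳ i j))
                    (m+n≡0⇒n≡0 (gap i (σ ⟨$⟩ʳ j)) eq)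
      -- The exchange settles both gaps it touches and the other gaps keep their occupants, so no
      -- fit is lost.
      same : ∀ k → Fits σ′ k ⊎ σ′ ⟨$⟩ʳ k ≡ σ ⟨$⟩ʳ k
      same k = by-cases (k ≟F i) (k ≟F j)
        where
        by-cases : Dec (k ≡ i) → Dec (k ≡ j) → Fits σ′ k ⊎ σ′ ⟨$⟩ʳ k ≡ σ ⟨$⟩ʳ k
        by-cases (yes refl) _          = inj₁ fitsᵢ
        by-cases (no _)     (yes refl) = inj₁ fitsⱼ
        by-cases (no k≢i)   (no k≢j)   = inj₂ (cong (σ ⟨$⟩ʳ_) (transpose-mismatch k≢i k≢j))
      keep : ∀ k → Fits σ k → Fits σ′ k
      keep k fits with same k
      ... | inj₁ fits′ = fits′
      ... | inj₂ e     = trans (cong (gap k) e) fits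
      fix′ : Fixable σ′
      fix′ k with same k
      ... | inj₁ fits′ = inj₁ fits′
      ... | inj₂ e     = subst (λ x → gap k x ≡ 0 ⊎ defect xy yx x + c ≤ a) (sym e) (fix k)

    fit-list : ∀ σ → Fixable σ → (is : List (Fin a)) →
               ∃ λ σ′ → Fixable σ′ × (∀ {i} → i ∈ is → Fits σ′ i)
    fit-list σ fix []       = σ , fix , λ ()
    fit-list σ fix (i ∷ is) with fit-list σ fix is
    ... | σ₁ , fix₁ , fits with fit σ₁ fix₁ i
    ...   | σ₂ , fix₂ , fitsᵢ , keep =
      σ₂ , fix₂ , λ { (here refl) → fitsᵢ ; (there i∈is) → keep _ (fits i∈is) }

    -- The costs of x over all a gaps sum to its defect, which is below a, so x fits somewhere.
    -- Placing the only vertex that may be too costly to exchange in such a gap makes the start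
    -- `Fixable`.
    arrangement : (∀ x → defect xy yx x < a) →
      (∀ {x x′} → x ≢ x′ → a < defect xy yx x + c → defect xy yx x′ + c ≤ a) →
      ∃ λ σ → ∀ i → Fits σ i
    arrangement defect<a unique = let σ , _ , fits = fit-list (proj₁ initial) (proj₂ initial) (allFin a)
                                  in σ , λ i → fits (∈-allFin i)
      where
      initial : ∃ Fixable
      initial with any? (λ x → suc a ≤? defect xy yx x + c)
      ... | no ¬large = idₚ , λ i → inj₂ (≮⇒≥ λ large → ¬large (i , large))
      ... | yes (x , large)
        with sum<n⇒∃zero (λ i → gap i x) (subst (_< a) (sym (sum-gapˡ x)) (defect<a x))
      ...   | g , eq = transpose g x , fix
        where
        τ = transpose g x
        fix : Fixable τ
        fix i = by-cases (i ≟F g)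
          where
          by-cases : Dec (i ≡ g) → Fits τ i ⊎ defect xy yx (τ ⟨$⟩ʳ i) + c ≤ a
          by-cases (yes refl) = inj₁ (trans (cong (gap g) (transpose-matchˡ g x)) eq)
          by-cases (no i≢g)   = inj₂ (unique (λ x≡τi → i≢g (Injection.injective (↔⇒↣ τ)
            (trans (sym x≡τi) (sym (transpose-matchˡ g x))))) large)

-- Common out-neighbours and the degree condition.

Shared : ∀ {a} → Matrix a → Fin a → Fin a → Set
Shared m i i′ = ∃ λ j → m i j ≡ true × m i′ j ≡ true

shared? : ∀ {a} (m : Matrix a) i i′ → Dec (Shared m i i′)
shared? m i i′ = any? λ j → (m i j ≟B true) ×-dec (m i′ j ≟B true)

Dominating Lonely : ∀ {a} → Matrix a → Fin a → Set
Dominating m i = ∃ λ i′ → i ≢ i′ × Shared m i i′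
Lonely m i = ∀ {i′} → Shared m i i′ → i ≡ i′

dominating? : ∀ {a} (m : Matrix a) i → Dec (Dominating m i)
dominating? m i = any? λ i′ → ¬? (i ≟F i′) ×-dec shared? m i i′

¬dominating⇒lonely : ∀ {a} (m : Matrix a) {i} → ¬ Dominating m i → Lonely m i
¬dominating⇒lonely m {i} ¬dom {i′} sh with i ≟F i′
... | yes i≡i′ = i≡i′
... | no  i≢i′ = contradiction (i′ , i≢i′ , sh) ¬dom

NonSharing : ∀ {a} → Matrix a → Set
NonSharing m = ∃ λ i → ∃ λ i′ → i ≢ i′ × ¬ Shared m i i′

nonSharing? : ∀ {a} (m : Matrix a) → Dec (NonSharing m)
nonSharing? m = any? λ i → any? λ i′ → ¬? (i ≟F i′) ×-dec ¬? (shared? m i i′)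

¬nonSharing⇒shared : ∀ {a} (m : Matrix a) → ¬ NonSharing m → ∀ {i i′} → i ≢ i′ → Shared m i i′
¬nonSharing⇒shared m ¬ns {i} {i′} i≢i′ with shared? m i i′
... | yes sh = sh
... | no ¬sh = contradiction (i , i′ , i≢i′ , ¬sh) ¬ns

few-missing⇒shared : ∀ {a} (m : Matrix a) {i i′} → row m i + row m i′ < a → Shared m i i′
few-missing⇒shared m {i} {i′} lt
  with sum<n⇒∃zero (λ j → miss (m i j) + miss (m i′ j))
         (subst (_< _) (sym (∑-distrib-+ (miss ∘ m i) (miss ∘ m i′))) lt)
... | j , eq = j , miss≡0 (m+n≡0⇒m≡0 _ eq) , miss≡0 (m+n≡0⇒n≡0 (miss (m i j)) eq)

missing⇒1≤col : ∀ {a} (m : Matrix a) {i j} → m i j ≡ false → 1 ≤ col m j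
missing⇒1≤col m {i} {j} eq = subst (_≤ col m j) (cong miss eq) (≤sum (λ k → miss (m k j)) i)

-- The degree condition restated: as a defect is 2a minus a degree, a degree sum of at least 4a - 3
-- is a defect sum of at most 3.
Sparse : ∀ {a} → Matrix a → Matrix a → Set
Sparse m m′ = ∀ {i i′} → i ≢ i′ → Shared m i i′ → defect m m′ i + defect m m′ i′ ≤ 3

defect≤3 : ∀ {a} {m m′ : Matrix a} → Sparse m m′ → ∀ {i} → Dominating m i → defect m m′ i ≤ 3
defect≤3 sparse (i′ , i≢i′ , sh) = ≤-trans (m≤m+n _ _) (sparse i≢i′ sh)

-- Every arc missing at i or i′ is also missing at its other end, on the opposite side. As i and i′
-- are distinct and on the same side, none is counted twice.
defect-pair≤ : ∀ {a} (m m′ : Matrix a) {i i′} → i ≢ i′ →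
               defect m m′ i + defect m m′ i′ ≤ sum (defect m′ m)
defect-pair≤ {a} m m′ {i} {i′} i≢i′ = begin
  defect m m′ i + defect m m′ i′       ≡⟨ cong₂ _+_ (expand i) (expand i′) ⟨
  sum (t i) + sum (t i′)               ≡⟨ ∑-distrib-+ (t i) (t i′) ⟨
  sum (λ j → t i j + t i′ j)           ≤⟨ sum-mono _ _ (λ j → ≤-trans (+≤sum (λ k → t k j) i≢i′)
                                           (≤-reflexive (trans (∑-distrib-+ (λ k → miss (m k j)) (λ k → miss (m′ j k)))
                                             (+-comm (col m j) _)))) ⟩
  sum (defect m′ m)                    ∎
  where
  t : Fin a → Fin a → ℕ
  t i j = miss (m i j) + miss (m′ j i)
  expand : ∀ i → sum (t i) ≡ defect m m′ i
  expand i = ∑-distrib-+ (miss ∘ m i) (λ j → miss (m′ j i))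

-- If i is the only in-neighbour of j, then j has defect at least a - 1 ≥ 3, so a partner
-- of j would have defect 0 and be a common out-neighbour of everything.
lonely-step : ∀ {a} {m m′ : Matrix a} → 4 ≤ a → Sparse m′ m →
              ∀ {i j} → Lonely m i → m i j ≡ true → Lonely m′ j
lonely-step {a} {m} {m′} 4≤a sparse {i} {j} lonely mij {j′} (k , m′jk , m′j′k) with j ≟F j′
... | yes j≡j′ = j≡j′
... | no  j≢j′ with 3 ≤? col m j
-- At most 2 of the at least 4 possible arcs into j are absent, so j has a second in-neighbour,
-- which contradicts the loneliness of i.
...   | no  col≱3 =
  let i′ , i′≢i , eq = 1+sum<n+w⇒∃zero (λ k → miss (m k j)) i
                         (≤-trans (≤-trans (s≤s (≰⇒> col≱3)) 4≤a) (m≤m+n a _))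
  in contradiction (sym (lonely (j , mij , miss≡0 eq))) i′≢i
...   | yes 3≤col =
  let i′ , i′≢i , eq = 1+sum<n+w⇒∃zero (λ k → miss (m k j′)) i
                         (≤-trans (≤-trans (s≤s (s≤s (≤-trans full z≤n))) (≤-trans (s≤s (s≤s z≤n)) 4≤a)) (m≤m+n a _))
  in contradiction (sym (lonely (j′ , full-arc i , miss≡0 eq))) i′≢i
  where
  full : col m j′ ≤ 0
  full = +-cancelˡ-≤ 3 _ _ (≤-trans
    (+-mono-≤ (≤-trans 3≤col (m≤n+m _ (row m′ j))) (m≤n+m _ (row m′ j′)))
    (sparse j≢j′ (k , m′jk , m′j′k)))
  full-arc : ∀ i → m i j′ ≡ true
  full-arc i = miss≡0 (n≤0⇒n≡0 (≤-trans (≤sum (λ k → miss (m k j′)) i) full))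

-- Arrangements when every vertex shares an out-neighbour.

module Dense {a} (4≤a : 4 ≤ a) (p : Fin a → Fin a) (p≢ : ∀ i → p i ≢ i)
  (sum-p : ∀ w → sum (w ∘ p) ≡ sum w) where

  -- Stated for a pair of matrices because either side may be the one that moves: the rows of `m`
  -- are placed into the gaps of the other side.
  Arranged : Matrix a → Matrix a → Set
  Arranged m m′ = ∃ λ (σ : Permutation′ a) → ∀ i →
    m′ (p i) (σ ⟨$⟩ʳ i) ≡ true × m (σ ⟨$⟩ʳ i) i ≡ true

  arrange : ∀ (m m′ : Matrix a) c → (∀ {y y′} → y ≢ y′ → row m′ y + col m y′ ≤ c) →
    (∀ x → defect m m′ x < a) →
    (∀ {x x′} → x ≢ x′ → a < defect m m′ x + c → defect m m′ x′ + c ≤ a) →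
    Arranged m m′
  arrange m m′ c row+col≤c small unique =
    let σ , fits = Arrangement.arrangement p p≢ sum-p m m′ c row+col≤c small unique
    in σ , λ i → miss≡0 (m+n≡0⇒m≡0 _ (fits i)) ,
                 miss≡0 (m+n≡0⇒n≡0 (miss (m′ (p i) (σ ⟨$⟩ʳ i))) (fits i))

  module _ {m m′ : Matrix a} (sparse : Sparse m m′) (sparse′ : Sparse m′ m)
    (dom : ∀ i → Dominating m i) (dom′ : ∀ j → Dominating m′ j) where

    private
      d d′ : Fin a → ℕ
      d  = defect m m′
      d′ = defect m′ m

      d<a : ∀ i → d i < a
      d<a i = ≤-trans (s≤s (defect≤3 sparse (dom i))) 4≤a

    all-shared⇒arranged : (∀ {i i′} → i ≢ i′ → Shared m i i′) →
      (∀ {j j′} → j ≢ j′ → Shared m′ j j′) → Arranged m m′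
    all-shared⇒arranged sh sh′ = arrange m m′ 3
      (λ {y} {y′} y≢y′ → ≤-trans (+-mono-≤ (m≤m+n (row m′ y) _) (m≤n+m _ (row m′ y′)))
                                 (sparse′ y≢y′ (sh′ y≢y′)))
      d<a
      -- From 4 ≤ a < d x + 3 follows 2 ≤ d x, which leaves at most 1 for d x′, and 1 + 3 ≤ a.
      λ {x} {x′} x≢x′ large → ≤-trans (+-monoˡ-≤ 3 (+-cancelˡ-≤ 2 (d x′) 1
        (≤-trans (+-monoˡ-≤ (d x′) (+-cancelʳ-≤ 3 2 (d x) (≤-trans (s≤s 4≤a) large)))
                 (sparse x≢x′ (sh x≢x′))))) 4≤a

    -- Every vertex on the other side misses an arc from the non-sharing pair,
    -- which leaves at most a + 1 missing arcs altogether.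
    nonSharing⇒arranged : NonSharing m → Arranged m m′
    nonSharing⇒arranged (u , u′ , u≢u′ , ¬sh) = arrange m m′ 2 row+col≤2 d<a unique
      where
      1≤col : ∀ j → 1 ≤ col m j
      1≤col j with m u j in eq | m u′ j in eq′
      ... | true  | true  = contradiction (j , eq , eq′) ¬sh
      ... | true  | false = missing⇒1≤col m eq′
      ... | false | _     = missing⇒1≤col m eq

      1≤d′ : ∀ j → 1 ≤ d′ j
      1≤d′ j = ≤-trans (1≤col j) (m≤n+m _ (row m′ j))

      d′≤2 : ∀ j → d′ j ≤ 2
      d′≤2 j with dom′ j
      ... | j′ , j≢j′ , sh = +-cancelʳ-≤ 1 (d′ j) 2
        (≤-trans (+-monoʳ-≤ (d′ j) (1≤d′ j′)) (sparse′ j≢j′ sh))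

      row≤1 : ∀ j → row m′ j ≤ 1
      row≤1 j = +-cancelʳ-≤ 1 (row m′ j) 1 (≤-trans (+-monoʳ-≤ (row m′ j) (1≤col j)) (d′≤2 j))

      -- Each row misses at most one arc and 2 < a, so any two rows share a column and the bound for
      -- sharing pairs holds for all pairs.
      pair≤3 : ∀ {j j′} → j ≢ j′ → d′ j + d′ j′ ≤ 3
      pair≤3 {j} {j′} j≢j′ = sparse′ j≢j′ (few-missing⇒shared m′
        (≤-trans (s≤s (+-mono-≤ (row≤1 j) (row≤1 j′))) (≤-trans (s≤s (s≤s (s≤s z≤n))) 4≤a)))

      -- At least one arc into j is missing and is not counted on the left, which improves 3 to 2.
      row+col≤2 : ∀ {j j′} → j ≢ j′ → row m′ j + col m j′ ≤ 2
      row+col≤2 {j} {j′} j≢j′ = ≤-pred (begin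
        1 + (row m′ j + col m j′)  ≡⟨ cong (_+ col m j′) (+-comm 1 (row m′ j)) ⟩
        row m′ j + 1 + col m j′    ≤⟨ +-mono-≤ (+-monoʳ-≤ (row m′ j) (1≤col j)) (m≤n+m _ (row m′ j′)) ⟩
        d′ j + d′ j′               ≤⟨ pair≤3 j≢j′ ⟩
        3                          ∎)

      -- Two defects of at least a - 1 would sum to 2a - 2, more than the a + 1 available, since 4 ≤
      -- a.
      unique : ∀ {x x′} → x ≢ x′ → a < d x + 2 → d x′ + 2 ≤ a
      unique {x} {x′} x≢x′ large = +-cancelˡ-≤ (suc a) _ _ (begin
        suc a + (d x′ + 2)      ≤⟨ +-monoˡ-≤ (d x′ + 2) large ⟩
        d x + 2 + (d x′ + 2)    ≡⟨ +-assoc (d x) 2 _ ⟩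
        d x + (2 + (d x′ + 2))  ≡⟨ cong (d x +_) (trans (+-comm 2 _) (+-assoc (d x′) 2 2)) ⟩
        d x + (d x′ + 4)        ≡⟨ +-assoc (d x) (d x′) 4 ⟨
        d x + d x′ + 4          ≤⟨ +-mono-≤ (≤-trans (defect-pair≤ m m′ x≢x′)
                                                     (sum≤1+n d′ 1≤d′ d′≤2 pair≤3)) 4≤a ⟩
        suc a + a               ∎)

  arranged : ∀ {m m′} → Sparse m m′ → Sparse m′ m →
    (∀ i → Dominating m i) → (∀ j → Dominating m′ j) → Arranged m m′ ⊎ Arranged m′ m
  arranged {m} {m′} sparse sparse′ dom dom′ with nonSharing? m | nonSharing? m′
  ... | yes ns | _       = inj₁ (nonSharing⇒arranged sparse sparse′ dom dom′ ns)
  ... | no _   | yes ns′ = inj₂ (nonSharing⇒arranged sparse′ sparse dom′ dom ns′)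
  ... | no ¬ns | no ¬ns′ = inj₁ (all-shared⇒arranged sparse sparse′ dom dom′
    (¬nonSharing⇒shared m ¬ns) (¬nonSharing⇒shared m′ ¬ns′))

-- Alternating vertex lists.

alternate : ∀ {n} {V : Set} → (Fin n → V) → (Fin n → V) → List V
alternate {zero}  f g = []
alternate {suc n} f g = f zero ∷ g zero ∷ alternate (f ∘ suc) (g ∘ suc)

module _ {V : Set} where

  ∈-alternate⁻ : ∀ {n} (f g : Fin n → V) {v} → v ∈ alternate f g → ∃ λ i → v ≡ f i ⊎ v ≡ g i
  ∈-alternate⁻ {suc n} f g (here v≡f₀)         = zero , inj₁ v≡f₀
  ∈-alternate⁻ {suc n} f g (there (here v≡g₀)) = zero , inj₂ v≡g₀
  ∈-alternate⁻ {suc n} f g (there (there v∈))  =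
    let i , eq = ∈-alternate⁻ (f ∘ suc) (g ∘ suc) v∈ in suc i , eq

  ∈-alternateˡ : ∀ {n} (f g : Fin n → V) i → f i ∈ alternate f g
  ∈-alternateˡ f g zero    = here refl
  ∈-alternateˡ f g (suc i) = there (there (∈-alternateˡ (f ∘ suc) (g ∘ suc) i))

  ∈-alternateʳ : ∀ {n} (f g : Fin n → V) i → g i ∈ alternate f g
  ∈-alternateʳ f g zero    = there (here refl)
  ∈-alternateʳ f g (suc i) = there (there (∈-alternateʳ (f ∘ suc) (g ∘ suc) i))

  alternate-unique : ∀ {n} (f g : Fin n → V) →
    (∀ {i j} → f i ≡ f j → i ≡ j) → (∀ {i j} → g i ≡ g j → i ≡ j) →
    (∀ i j → f i ≢ g j) → Unique (alternate f g)
  alternate-unique {zero}  f g f-inj g-inj f≢g = []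
  alternate-unique {suc n} f g f-inj g-inj f≢g =
    (f≢g zero zero ∷ ¬Any⇒All¬ _ f₀∉) ∷ ¬Any⇒All¬ _ g₀∉ ∷
    alternate-unique (f ∘ suc) (g ∘ suc) (suc-injective ∘ f-inj) (suc-injective ∘ g-inj)
      (λ i j → f≢g (suc i) (suc j))
    where
    f₀∉ : f zero ∉ alternate (f ∘ suc) (g ∘ suc)
    f₀∉ f₀∈ with ∈-alternate⁻ (f ∘ suc) (g ∘ suc) f₀∈
    ... | i , inj₁ eq = contradiction (f-inj eq) λ ()
    ... | i , inj₂ eq = f≢g zero (suc i) eq
    g₀∉ : g zero ∉ alternate (f ∘ suc) (g ∘ suc)
    g₀∉ g₀∈ with ∈-alternate⁻ (f ∘ suc) (g ∘ suc) g₀∈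
    ... | i , inj₁ eq = f≢g (suc i) zero (sym eq)
    ... | i , inj₂ eq = contradiction (g-inj eq) λ ()

-- From degrees to defects.

count-tabulate : ∀ {n} {V : Set} (q : V → Bool) (f : Fin n → V) →
                 length (filterᵇ q (tabulate f)) + sum (miss ∘ q ∘ f) ≡ n
count-tabulate {zero}  q f = refl
count-tabulate {suc n} q f with q (f zero)
... | true  = cong suc (count-tabulate q (f ∘ suc))
... | false = trans (+-suc _ _) (cong suc (count-tabulate q (f ∘ suc)))

count-none : ∀ {n} {V : Set} (q : V → Bool) (f : Fin n → V) → (∀ i → q (f i) ≡ false) →
             length (filterᵇ q (tabulate f)) ≡ 0
count-none {zero}  q f none = refl
count-none {suc n} q f none with q (f zero) | none zero
... | false | _ = count-none q (f ∘ suc) (none ∘ suc)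

module Graph {a} (D : BipDigraph a) where
  open BipDigraph D
  open DecMembership (≡-dec (_≟F_ {a}) (_≟F_ {a})) using (_∈?_)

  private
    V : Set
    V = Vertex D

  count-vertices : ∀ (q : V → Bool) → length (filterᵇ q (vertices D)) ≡
    length (filterᵇ q (tabulate inj₁)) + length (filterᵇ q (tabulate inj₂))
  count-vertices q = begin-equality
    length (filterᵇ q (vertices D))
      ≡⟨ cong₂ (λ xs ys → length (filterᵇ q (xs ++ ys))) (map-tabulate id inj₁) (map-tabulate id inj₂) ⟩
    length (filterᵇ q (tabulate inj₁ ++ tabulate inj₂))
      ≡⟨ cong length (filter-++ (T? ∘ q) (tabulate inj₁) (tabulate inj₂)) ⟩
    length (filterᵇ q (tabulate inj₁) ++ filterᵇ q (tabulate inj₂))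
      ≡⟨ length-++ (filterᵇ q (tabulate inj₁)) ⟩
    length (filterᵇ q (tabulate inj₁)) + length (filterᵇ q (tabulate inj₂)) ∎

  countˡ : ∀ (q : V → Bool) → (∀ j → q (inj₂ j) ≡ false) →
           length (filterᵇ q (vertices D)) + sum (λ i → miss (q (inj₁ i))) ≡ a
  countˡ q none = begin-equality
    length (filterᵇ q (vertices D)) + missing
      ≡⟨ cong (_+ missing) (count-vertices q) ⟩
    length (filterᵇ q (tabulate inj₁)) + length (filterᵇ q (tabulate inj₂)) + missing
      ≡⟨ cong (λ k → length (filterᵇ q (tabulate inj₁)) + k + missing) (count-none q inj₂ none) ⟩
    length (filterᵇ q (tabulate inj₁)) + 0 + missing
      ≡⟨ cong (_+ missing) (+-identityʳ (length (filterᵇ q (tabulate inj₁)))) ⟩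
    length (filterᵇ q (tabulate inj₁)) + missing
      ≡⟨ count-tabulate q inj₁ ⟩
    a ∎
    where missing = sum (λ i → miss (q (inj₁ i)))

  countʳ : ∀ (q : V → Bool) → (∀ i → q (inj₁ i) ≡ false) →
           length (filterᵇ q (vertices D)) + sum (λ j → miss (q (inj₂ j))) ≡ a
  countʳ q none = begin-equality
    length (filterᵇ q (vertices D)) + missing
      ≡⟨ cong (_+ missing) (count-vertices q) ⟩
    length (filterᵇ q (tabulate inj₁)) + length (filterᵇ q (tabulate inj₂)) + missing
      ≡⟨ cong (λ k → k + length (filterᵇ q (tabulate inj₂)) + missing) (count-none q inj₁ none) ⟩
    length (filterᵇ q (tabulate inj₂)) + missing
      ≡⟨ count-tabulate q inj₂ ⟩
    a ∎
    where missing = sum (λ j → miss (q (inj₂ j)))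

  defectᵛ : V → ℕ
  defectᵛ (inj₁ i) = defect xy yx i
  defectᵛ (inj₂ j) = defect yx xy j

  deg+defect : ∀ v → deg D v + defectᵛ v ≡ a + a
  deg+defect (inj₁ i) = trans (+-interchange (outdeg D (inj₁ i)) _ _ _)
    (cong₂ _+_ (countʳ (arc D (inj₁ i)) λ _ → refl) (countʳ (λ u → arc D u (inj₁ i)) λ _ → refl))
  deg+defect (inj₂ j) = trans (+-interchange (outdeg D (inj₂ j)) _ _ _)
    (cong₂ _+_ (countˡ (arc D (inj₂ j)) λ _ → refl) (countˡ (λ u → arc D u (inj₂ j)) λ _ → refl))

  defect-sum≤3 : ∀ u v → 4 * a ∸ 3 ≤ deg D u + deg D v → defectᵛ u + defectᵛ v ≤ 3
  defect-sum≤3 u v large = +-cancelˡ-≤ (deg D u + deg D v) _ _ (begin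
    deg D u + deg D v + (defectᵛ u + defectᵛ v)     ≡⟨ +-interchange (deg D u) _ _ _ ⟩
    (deg D u + defectᵛ u) + (deg D v + defectᵛ v)   ≡⟨ cong₂ _+_ (deg+defect u) (deg+defect v) ⟩
    (a + a) + (a + a)                               ≡⟨ solve 1 (λ a → (a :+ a) :+ (a :+ a) := con 4 :* a) refl a ⟩
    -- This inequality holds whether or not `∸` truncates.
    4 * a                                           ≤⟨ m≤n+m∸n (4 * a) 3 ⟩
    3 + (4 * a ∸ 3)                                 ≤⟨ +-monoʳ-≤ 3 large ⟩
    3 + (deg D u + deg D v)                         ≡⟨ +-comm 3 _ ⟩
    deg D u + deg D v + 3                           ∎)
    where
    open +-*-Solver

  -- Cycles of a digraph.

  alternate-chain : ∀ {n} (f g : Fin (suc n) → V) {w} → (∀ i → Arc D (f i) (g i)) →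
    (∀ i → Arc D (g (inject₁ i)) (f (suc i))) → Arc D (g (fromℕ n)) w →
    ChainArcs D (f zero) (g zero ∷ alternate (f ∘ suc) (g ∘ suc)) w
  alternate-chain {zero}  f g fg gf gw = fg zero , gw
  alternate-chain {suc n} f g fg gf gw = fg zero , gf zero ,
    alternate-chain (f ∘ suc) (g ∘ suc) (fg ∘ suc) (gf ∘ suc) gw

  -- At `suc i` the condition on `cpred` links consecutive pairs of the list; at `zero` it closes
  -- the cycle.
  alternate-hamiltonian : ∀ {n} (f g : Fin (suc n) → V) →
    (∀ {i j} → f i ≡ f j → i ≡ j) → (∀ {i j} → g i ≡ g j → i ≡ j) → (∀ i j → f i ≢ g j) →
    (∀ v → ∃ λ i → v ≡ f i ⊎ v ≡ g i) →
    (∀ i → Arc D (f i) (g i)) → (∀ i → Arc D (g (cpred i)) (f i)) → Hamiltonian D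
  alternate-hamiltonian f g f-inj g-inj f≢g cover fg gf = record
    { cycle    = alternate f g
    ; distinct = alternate-unique f g f-inj g-inj f≢g
    ; covers   = covers
    ; isCycle  = alternate-chain f g fg (gf ∘ suc) (gf zero)
    }
    where
    covers : ∀ v → v ∈ alternate f g
    covers v with cover v
    ... | i , inj₁ refl = ∈-alternateˡ f g i
    ... | i , inj₂ refl = ∈-alternateʳ f g i

  -- The target w is kept apart from the start u because loop erasure moves the start while w stays
  -- fixed. For w = u this is a cycle.
  Cyclic : V → List V → V → Set
  Cyclic u vs w = ChainArcs D u vs w × Unique (u ∷ vs)

  chain-suffix : ∀ {u vs w x} → x ∈ u ∷ vs → Cyclic u vs w → ∃ λ ws → Cyclic x ws w
  chain-suffix (here refl)           c                     = _ , c
  chain-suffix {vs = _ ∷ _} (there x∈) ((_ , arcs) , _ ∷ uniq) = chain-suffix x∈ (arcs , uniq)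

  -- If x recurs later on, the list is cut back to that occurrence; otherwise x is prepended.
  loop-erase : ∀ {x w t} → Arc D w t → Star (Arc D) x w → ∃ λ vs → Cyclic x vs t
  loop-erase wt ε = [] , wt , [] ∷ []
  loop-erase {x} wt (_◅_ {j = y} xy path) with loop-erase wt path
  ... | vs , arcs , uniq with x ∈? (y ∷ vs)
  ...   | yes x∈ = chain-suffix x∈ (arcs , uniq)
  ...   | no  x∉ = y ∷ vs , (xy , arcs) , ¬Any⇒All¬ _ x∉ ∷ uniq

  -- Together with `pred-arc` this gives every vertex of a cycle an in-neighbour on it: the last
  -- vertex for the start, the list predecessor for the others.
  last-arc : ∀ {u} vs {w} → ChainArcs D u vs w → ∃ λ v → v ∈ u ∷ vs × Arc D v w
  last-arc []       arc          = _ , here refl , arc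
  last-arc (v ∷ vs) (_ , arcs) = let z , z∈ , arc = last-arc vs arcs in z , there z∈ , arc

  pred-arc : ∀ {u} vs {w x} → ChainArcs D u vs w → x ∈ vs → ∃ λ v → v ∈ u ∷ vs × Arc D v x
  pred-arc (v ∷ vs) (arc , _)    (here refl) = _ , here refl , arc
  pred-arc (v ∷ vs) (_   , arcs) (there x∈)  =
    let z , z∈ , arc = pred-arc vs arcs x∈ in z , there z∈ , arc

  -- A cycle is closed under in-neighbours as soon as these are unique.
  unique-in⇒hamiltonian : StronglyConnected D → ∀ {u v} → Arc D u v →
    (∀ {x y z} → Arc D x z → Arc D y z → x ≡ y) → Hamiltonian D
  unique-in⇒hamiltonian strong {u} {v} uv unique with loop-erase uv (strong v u)
  ... | vs , arcs , uniq = record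
    { cycle = v ∷ vs ; distinct = uniq ; covers = λ x → closed (strong x v) (here refl) ; isCycle = arcs }
    where
    closed₁ : ∀ {x y} → Arc D x y → y ∈ v ∷ vs → x ∈ v ∷ vs
    closed₁ xy (here refl) = let z , z∈ , zy = last-arc vs arcs in subst (_∈ v ∷ vs) (unique zy xy) z∈
    closed₁ xy (there y∈)  = let z , z∈ , zy = pred-arc vs arcs y∈ in subst (_∈ v ∷ vs) (unique zy xy) z∈
    closed : ∀ {x y} → Star (Arc D) x y → y ∈ v ∷ vs → x ∈ v ∷ vs
    closed ε           y∈ = y∈
    closed (xz ◅ path) y∈ = closed₁ xz (closed path y∈)

  -- Digraphs with a lonely vertex.

  Lonelyᵛ : V → Set
  Lonelyᵛ (inj₁ i) = Lonely xy i
  Lonelyᵛ (inj₂ j) = Lonely yx j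

  module _ (degrees : ∀ x y → ¬ x ≡ y → ∃ (λ z → Arc D x z × Arc D y z) →
                      4 * a ∸ 3 ≤ deg D x + deg D y) where

    sparseˣ : Sparse xy yx
    sparseˣ i≢i′ (j , ij , i′j) = defect-sum≤3 _ _
      (degrees _ _ (i≢i′ ∘ inj₁-injective) (inj₂ j , ij , i′j))

    sparseʸ : Sparse yx xy
    sparseʸ j≢j′ (i , ji , j′i) = defect-sum≤3 _ _
      (degrees _ _ (j≢j′ ∘ inj₂-injective) (inj₁ i , ji , j′i))

    -- Loneliness spreads along arcs by `lonely-step`, hence everywhere by strong connectivity. If
    -- all vertices are lonely, no vertex has two in-neighbours.
    lonely-hamiltonian : 4 ≤ a → StronglyConnected D →
                         ∀ {v} → Lonelyᵛ v → Hamiltonian D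
    lonely-hamiltonian 4≤a strong {v} lonely =
      -- Any arc serves as the start; x has one because a path from it to the other side is not
      -- empty.
      let x = inj₁ (index v)
          w , xw = first-arc {x} {inj₂ (index v)} (λ ()) (strong _ _)
      in unique-in⇒hamiltonian strong {x} {w} xw unique
      where
      step : ∀ {u w} → Arc D u w → Lonelyᵛ u → Lonelyᵛ w
      step {inj₁ _} {inj₂ _} uw l = lonely-step {m = xy} {yx} 4≤a sparseʸ l uw
      step {inj₂ _} {inj₁ _} uw l = lonely-step {m = yx} {xy} 4≤a sparseˣ l uw
      spread : ∀ {u w} → Star (Arc D) u w → Lonelyᵛ u → Lonelyᵛ w
      spread ε           l = l
      spread (uw ◅ path) l = spread path (step uw l)
      all-lonely : ∀ u → Lonelyᵛ u
      all-lonely u = spread (strong v u) lonely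
      unique : ∀ {x y z} → Arc D x z → Arc D y z → x ≡ y
      unique {inj₁ x} {inj₁ y} {inj₂ z} xz yz = cong inj₁ (all-lonely (inj₁ x) (z , xz , yz))
      unique {inj₂ x} {inj₂ y} {inj₁ z} xz yz = cong inj₂ (all-lonely (inj₂ x) (z , xz , yz))
      first-arc : ∀ {x y} → x ≢ y → Star (Arc D) x y → ∃ (Arc D x)
      first-arc x≢x ε        = contradiction refl x≢x
      first-arc _   (xz ◅ _) = _ , xz
      index : V → Fin a
      index (inj₁ i) = i
      index (inj₂ j) = j

-- From arrangements to Hamiltonian cycles.

open Graph

lonely-or-dominating : ∀ {a} (m : Matrix a) → ∃ (Lonely m) ⊎ (∀ i → Dominating m i)
lonely-or-dominating m with any? (λ i → ¬? (dominating? m i))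
... | yes (i , ¬dom) = inj₁ (i , ¬dominating⇒lonely m ¬dom)
... | no  ¬∃¬dom     = inj₂ λ i → decidable-stable (dominating? m i) λ ¬dom → ¬∃¬dom (i , ¬dom)

-- The moved side is listed by gap as `f` and the fixed side is `g`, so the vertex in gap i stands
-- between `g (cpred i)` and `g i`.
arranged⇒hamiltonian : ∀ {n} (D : BipDigraph (suc (suc n))) (4≤a : 4 ≤ suc (suc n)) →
  let open BipDigraph D ; open Dense 4≤a cpred cpred≢ sum-cpred
  in Arranged xy yx ⊎ Arranged yx xy → Hamiltonian D
arranged⇒hamiltonian D _ (inj₁ (σ , fits)) = alternate-hamiltonian D (inj₁ ∘ (σ ⟨$⟩ʳ_)) inj₂
  (Injection.injective (↔⇒↣ σ) ∘ inj₁-injective) inj₂-injective (λ _ _ ())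
  (λ { (inj₁ x) → σ ⟨$⟩ˡ x , inj₁ (cong inj₁ (sym (inverseʳ σ))) ; (inj₂ y) → y , inj₂ refl })
  (proj₂ ∘ fits) (proj₁ ∘ fits)
arranged⇒hamiltonian D _ (inj₂ (σ , fits)) = alternate-hamiltonian D (inj₂ ∘ (σ ⟨$⟩ʳ_)) inj₁
  (Injection.injective (↔⇒↣ σ) ∘ inj₂-injective) inj₁-injective (λ _ _ ())
  (λ { (inj₂ x) → σ ⟨$⟩ˡ x , inj₁ (cong inj₂ (sym (inverseʳ σ))) ; (inj₁ y) → y , inj₂ refl })
  (proj₂ ∘ fits) (proj₁ ∘ fits)

theorem1p10 : (a : ℕ) → 4 ≤ a → (D : BipDigraph a) →
    StronglyConnected D →
    (∀ x y → ¬ x ≡ y → ∃ (λ z → Arc D x z × Arc D y z) →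
    4 * a ∸ 3 ≤ deg D x + deg D y) →
    ¬ Isomorphic D D8 →
    Hamiltonian D
theorem1p10 (suc zero) (s≤s ())
theorem1p10 a@(suc (suc n)) 4≤a D strong degrees _
  with lonely-or-dominating xy | lonely-or-dominating yx
  where open BipDigraph D
... | inj₁ (i , l) | _            = lonely-hamiltonian D degrees 4≤a strong {inj₁ i} l
... | inj₂ _       | inj₁ (j , l) = lonely-hamiltonian D degrees 4≤a strong {inj₂ j} l
... | inj₂ dom     | inj₂ dom′    = arranged⇒hamiltonian D 4≤a
  (Dense.arranged 4≤a cpred cpred≢ sum-cpred (sparseˣ D degrees) (sparseʸ D degrees) dom dom′)
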